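{- Consider the following schemas: $\mathrm{TTL}$ (all instances $\mathrm{TTL}_{A,T}$, $A$ a type, $T:\mathcal P(A^*)$); $\overline{\mathrm{TTL}_{A\,\mathbf C_A}}$ (all instances $\mathrm{TTL}_{A,T}$ with $A$ a type and $T\in\mathbf C_A$, i.e. $T$ a list of chains of $A$); $\mathrm{Zorn}$ (all instances $\mathrm{Zorn}_{A,<,E}$); and $\overline{\mathrm{Zorn}_{\mathcal P(A)\subset\langle T\rangle}}$ (all instances of Zorn's lemma for the type $\mathcal P(A)$, strictly ordered by $\subset$, and the predicate $\langle T\rangle$, for $A$ a type and $T:\mathcal P(A^*)$). Then $$\overline{\mathrm{TTL}_{A\,\mathbf C_A}}\to\mathrm{Zorn}\qquad\text{and}\qquad\overline{\mathrm{Zorn}_{\mathcal P(A)\subset\langle T\rangle}}\to\mathrm{TTL}.$$ Hence $\mathrm{TTL}\leftrightarrow\overline{\mathrm{TTL}_{A\,\mathbf C_A}}$ and $\mathrm{Zorn}\leftrightarrow\overline{\mathrm{Zorn}_{\mathcal P(A)\subset\langle T\rangle}}$.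
   Context: Setting: intuitionistic higher-order arithmetic with inductive types and extensional equality of predicates; no choice principle is assumed. $\mathcal P(A)$ denotes $A\to\mathrm{Prop}$, with $a\in P$ meaning $P(a)$ and $P\subseteq Q$ meaning $\forall a,\ a\in P\to a\in Q$. On $\mathcal P(A)$, as a strict order, $\alpha\subset\beta$ denotes proper inclusion ($\alpha\subseteq\beta$ and $\alpha\ne\beta$). $A^*$ is the type of finite lists over $A$, $\varepsilon$ the empty list, $u@a$ the list $u$ with $a$ appended at the end, $\star$ concatenation; $a\in u$ means $a$ occurs in $u$; for lists, $u\subseteq v$ means $\forall a,\ a\in u\to a\in v$. Teichmüller-Tukey lemma. For a list $u:A^*$ and $\alpha:\mathcal P(A)$, $u\subset\alpha$ means $\forall a,\ a\in u\to a\in\alpha$. For $T:\mathcal P(A^*)$, $\langle T\rangle:=\{\alpha:\mathcal P(A)\mid\forall u^{A^*},\ u\subset\alpha\to u\in T\}$. For $\alpha,\beta:\mathcal P(A)$, $\beta\prec\alpha$ means there is $a:A$ with $a\notin\alpha$ and $\beta=\lambda x.\,(x\in\alpha\vee x=a)$. $\alpha\in\mathrm{Max}_\prec(P)$ means $\alpha\in P$ and $\forall\beta^{\mathcal P(A)},\ \beta\prec\alpha\to\beta\notin P$. $\mathrm{TTL}_{A,T}$ is: $(\exists\alpha^{\mathcal P(A)},\ \alpha\in\langle T\rangle)\to\exists\alpha^{\mathcal P(A)},\ \alpha\in\mathrm{Max}_\prec(\langle T\rangle)$. Zorn's lemma. Let $<$ be a strict order on $A$, $\leq$ its reflexive closure,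 and $E,F:\mathcal P(A)$. $F$ is a chain if $\forall a,b^A$, $a,b\in F\to(a<b\vee b<a\vee a=b)$; $F$ is a subchain of $E$ if $F\subseteq E$ and $F$ is a chain; $E$ is inductive if for every subchain $F$ of $E$ there is $a\in E$ with $\forall b\in F,\ b\leq a$. $a\in\mathrm{Max}_<(E)$ means $a\in E$ and $\forall b^A,\ a<b\to b\notin E$. $\mathrm{Zorn}_{A,<,E}$ is: if $E$ is inductive then $\exists a^A,\ a\in\mathrm{Max}_<(E)$. List of chains. $T:\mathcal P(A^*)$ is a list of chains of $A$ if there is $T':\mathcal P(A^*)$ such that: $\varepsilon\in T'$; for all $u,v,a$, ($u@a\in T'$ and $[a]\star v\in T'$) if and only if $u\star[a]\star v\in T'$; for all $u,v,a$, $u\star[a]\star v\in T'$ implies $u\star v\in T'$; if $a\neq b$ and $u\star[a]\star v\star[b]\star w\in T'$ then for all $u',v',w':A^*$, $u'\star[b]\star v'\star[a]\star w'\notin T'$; and $T$ is the downward closure of $T'$ under $\subseteq$, i.e. $u\in T$ iff there is $w\in T'$ with $u\subseteq w$. $\mathbf C_A$ is the collection of lists of chains of $A$.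
   Formalization: The reflexive closure a ≤ b is read as "a ≠ b implies a < b" (classically the same as "a < b or a = b"); with the disjunctive reading the implication from Zorn for P(A), ⊂, ⟨T⟩ to TTL is not intuitionistically derivable. -}

module Defs where

open import Data.Empty using (⊥)
open import Data.List.Base using (List; []; [_]; _++_; _∷ʳ_)
open import Data.List.Membership.Propositional using () renaming (_∈_ to _∈ᴸ_)
open import Data.Product.Base using (Σ; _×_; _,_)
open import Data.Sum.Base using (_⊎_; inj₁; inj₂)
open import Relation.Binary.PropositionalEquality.Core using (_≡_)

-- Intuitionistic higher-order logic with an impredicative type Ω of
-- propositions.  The types of the logic are the elements of Set; since Ω is in
-- Set, so is A → Ω, and one may quantify over it inside Ω.  Agda's own
-- predicates A → Set would not do: the union of a predicate on A → Set is not
-- in A → Set.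
--
-- ∥ X ∥ is the proposition "X is inhabited".  It is eliminated only into
-- propositions, hence no choice principle (not even unique choice) comes with
-- ∃′ or ∨, and excluded middle is not assumed.  In the Calculus of Inductive
-- Constructions, Ω = Prop and ∥ X ∥ = inhabited X.
record HigherOrderLogic : Set₁ where
  field
    Ω       : Set
    ⊢_      : Ω → Set
    ∥_∥     : Set → Ω
    ∥∥-intro : {X : Set} → X → ⊢ ∥ X ∥
    ∥∥-elim  : {X : Set} {p : Ω} → (X → ⊢ p) → ⊢ ∥ X ∥ → ⊢ p
    predicate-ext : {A : Set} (α β : A → Ω) →
                    (∀ a → ⊢ α a → ⊢ β a) → (∀ a → ⊢ β a → ⊢ α a) →
                    ⊢ ∥ α ≡ β ∥

  infix  0 ⊢_
  infixr 1 _⇒_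
  infix  1 _⇔_
  infixr 2 _∨_
  infixr 3 _∧_
  infix  4 _≐_ _≠_
  infix  5 ¬′_

  ⊥′ : Ω
  ⊥′ = ∥ ⊥ ∥

  _⇒_ _∧_ _∨_ _⇔_ : Ω → Ω → Ω
  p ⇒ q = ∥ (⊢ p → ⊢ q) ∥
  p ∧ q = ∥ (⊢ p) × (⊢ q) ∥
  p ∨ q = ∥ (⊢ p) ⊎ (⊢ q) ∥
  p ⇔ q = (p ⇒ q) ∧ (q ⇒ p)

  ¬′_ : Ω → Ω
  ¬′ p = p ⇒ ⊥′

  ∀′ ∃′ : (A : Set) → (A → Ω) → Ω
  ∀′ A P = ∥ (∀ (a : A) → ⊢ P a) ∥
  ∃′ A P = ∥ Σ A (λ a → ⊢ P a) ∥

  infix 0 ∀′ ∃′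
  syntax ∀′ A (λ a → p) = ∀[ a ∶ A ] p
  syntax ∃′ A (λ a → p) = ∃[ a ∶ A ] p

  _≐_ _≠_ : {A : Set} → A → A → Ω
  a ≐ b = ∥ a ≡ b ∥
  a ≠ b = ¬′ (a ≐ b)

  𝒫 : Set → Set
  𝒫 A = A → Ω

module Principles (L : HigherOrderLogic) where
  open HigherOrderLogic L public

  infix 4 _∈_ _∉_ _⊆_ _⊂_ _∈ˡ_ _⊆ˡ_ _⊂ˡ_ _≺_

  _∈_ _∉_ : {A : Set} → A → 𝒫 A → Ω
  a ∈ P = P a
  a ∉ P = ¬′ (a ∈ P)

  _⊆_ _⊂_ : {A : Set} → 𝒫 A → 𝒫 A → Ω
  _⊆_ {A} P Q = ∀[ a ∶ A ] (a ∈ P ⇒ a ∈ Q)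
  α ⊂ β = α ⊆ β ∧ α ≠ β

  _∈ˡ_ : {A : Set} → A → List A → Ω
  a ∈ˡ u = ∥ a ∈ᴸ u ∥

  _⊆ˡ_ : {A : Set} → List A → List A → Ω
  _⊆ˡ_ {A} u v = ∀[ a ∶ A ] (a ∈ˡ u ⇒ a ∈ˡ v)

  -- Inclusion of a list in a predicate; not proper, unlike _⊂_.
  _⊂ˡ_ : {A : Set} → List A → 𝒫 A → Ω
  _⊂ˡ_ {A} u α = ∀[ a ∶ A ] (a ∈ˡ u ⇒ a ∈ α)

  ⟨_⟩ : {A : Set} → 𝒫 (List A) → 𝒫 (𝒫 A)
  ⟨_⟩ {A} T α = ∀[ u ∶ List A ] (u ⊂ˡ α ⇒ u ∈ T)

  -- β ≺ α: β is the larger predicate, α with one new element.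
  _≺_ : {A : Set} → 𝒫 A → 𝒫 A → Ω
  _≺_ {A} β α = ∃[ a ∶ A ] (a ∉ α ∧ β ≐ (λ x → x ∈ α ∨ x ≐ a))

  Max≺ : {A : Set} → 𝒫 (𝒫 A) → 𝒫 (𝒫 A)
  Max≺ {A} P α = α ∈ P ∧ (∀[ β ∶ 𝒫 A ] (β ≺ α ⇒ β ∉ P))

  TTL[_,_] : (A : Set) → 𝒫 (List A) → Ω
  TTL[ A , T ] = (∃[ α ∶ 𝒫 A ] (α ∈ ⟨ T ⟩)) ⇒ (∃[ α ∶ 𝒫 A ] (α ∈ Max≺ ⟨ T ⟩))

  StrictOrder : {A : Set} → (A → A → Ω) → Ω
  StrictOrder {A} _<_ =
    (∀[ a ∶ A ] (¬′ (a < a)))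
    ∧ (∀[ a ∶ A ] (∀[ b ∶ A ] (∀[ c ∶ A ] (a < b ⇒ b < c ⇒ a < c))))

  -- Reflexive closure, read as "a < b unless a = b".  Classically this is
  -- a < b ∨ a ≐ b (see closure-sound and closure-complete).  Intuitionistically
  -- the disjunction is too strong: for α ⊆ β it would require deciding α ≐ β,
  -- so a chain of predicates would not be bounded by its union, whereas
  -- α ⊆ β always gives Refl _⊂_ α β.
  Refl : {A : Set} → (A → A → Ω) → (A → A → Ω)
  Refl _<_ a b = a ≠ b ⇒ a < b

  IsChain : {A : Set} → (A → A → Ω) → 𝒫 A → Ω
  IsChain {A} _<_ F =
    ∀[ a ∶ A ] (∀[ b ∶ A ] (a ∈ F ∧ b ∈ F ⇒ (a < b ∨ b < a ∨ a ≐ b)))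

  IsSubchain : {A : Set} → (A → A → Ω) → 𝒫 A → 𝒫 A → Ω
  IsSubchain _<_ E F = F ⊆ E ∧ IsChain _<_ F

  Inductive : {A : Set} → (A → A → Ω) → 𝒫 A → Ω
  Inductive {A} _<_ E =
    ∀[ F ∶ 𝒫 A ] (IsSubchain _<_ E F ⇒
      (∃[ a ∶ A ] (a ∈ E ∧ (∀[ b ∶ A ] (b ∈ F ⇒ Refl _<_ b a)))))

  Max : {A : Set} → (A → A → Ω) → 𝒫 A → 𝒫 A
  Max {A} _<_ E a = a ∈ E ∧ (∀[ b ∶ A ] (a < b ⇒ b ∉ E))

  Zorn[_,_,_] : (A : Set) → (A → A → Ω) → 𝒫 A → Ω
  Zorn[ A , _<_ , E ] = Inductive _<_ E ⇒ (∃[ a ∶ A ] (a ∈ Max _<_ E))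

  IsChainBasis : {A : Set} → 𝒫 (List A) → Ω
  IsChainBasis {A} T′ =
    ([] ∈ T′)
    ∧ (∀[ u ∶ List A ] (∀[ v ∶ List A ] (∀[ a ∶ A ]
        ((u ∷ʳ a) ∈ T′ ∧ ([ a ] ++ v) ∈ T′ ⇔ (u ++ [ a ] ++ v) ∈ T′))))
    ∧ (∀[ u ∶ List A ] (∀[ v ∶ List A ] (∀[ a ∶ A ]
        ((u ++ [ a ] ++ v) ∈ T′ ⇒ (u ++ v) ∈ T′))))
    ∧ (∀[ a ∶ A ] (∀[ b ∶ A ]
        (∀[ u ∶ List A ] (∀[ v ∶ List A ] (∀[ w ∶ List A ]
          (a ≠ b ∧ (u ++ [ a ] ++ v ++ [ b ] ++ w) ∈ T′ ⇒
            (∀[ u′ ∶ List A ] (∀[ v′ ∶ List A ] (∀[ w′ ∶ List A ]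
              ((u′ ++ [ b ] ++ v′ ++ [ a ] ++ w′) ∉ T′))))))))))

  𝐂 : (A : Set) → 𝒫 (𝒫 (List A))
  𝐂 A T = ∃[ T′ ∶ 𝒫 (List A) ]
    (IsChainBasis T′
     ∧ (∀[ u ∶ List A ] (u ∈ T ⇔ (∃[ w ∶ List A ] (w ∈ T′ ∧ u ⊆ˡ w)))))

  TTL : Set₁
  TTL = (A : Set) (T : 𝒫 (List A)) → ⊢ TTL[ A , T ]

  TTL-𝐂 : Set₁
  TTL-𝐂 = (A : Set) (T : 𝒫 (List A)) → ⊢ T ∈ 𝐂 A → ⊢ TTL[ A , T ]

  Zorn : Set₁
  Zorn = (A : Set) (_<_ : A → A → Ω) (E : 𝒫 A) →
         ⊢ StrictOrder _<_ → ⊢ Zorn[ A , _<_ , E ]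

  Zorn-𝒫 : Set₁
  Zorn-𝒫 = (A : Set) (T : 𝒫 (List A)) → ⊢ Zorn[ 𝒫 A , _⊂_ , ⟨ T ⟩ ]

  closure-sound : {A : Set} (_<_ : A → A → Ω) (a b : A) →
                  ⊢ (a < b ∨ a ≐ b) → ⊢ Refl _<_ a b
  closure-sound _<_ a b = ∥∥-elim λ where
    (inj₁ a<b) → ∥∥-intro λ _ → a<b
    (inj₂ a≐b) → ∥∥-intro λ a≠b →
      ∥∥-elim (λ ()) (∥∥-elim {p = ⊥′} (λ f → f a≐b) a≠b)

  closure-complete : ((p : Ω) → ⊢ (p ∨ ¬′ p)) →
                     {A : Set} (_<_ : A → A → Ω) (a b : A) →
                     ⊢ Refl _<_ a b → ⊢ (a < b ∨ a ≐ b)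
  closure-complete em _<_ a b a≤b = ∥∥-elim
    (λ where
      (inj₁ a≐b) → ∥∥-intro (inj₂ a≐b)
      (inj₂ a≠b) → ∥∥-intro (inj₁ (∥∥-elim (λ f → f a≠b) a≤b)))
    (em (a ≐ b))

  ⊆⇒Refl-⊂ : {A : Set} (α β : 𝒫 A) → ⊢ α ⊆ β → ⊢ Refl _⊂_ α β
  ⊆⇒Refl-⊂ α β α⊆β = ∥∥-intro λ α≠β → ∥∥-intro (α⊆β , α≠β)

{-# OPTIONS --safe #-}

-- TTL-𝐂 → Zorn.  Let T be the list of chains of A generated by the strictly
-- <-increasing lists of elements of E.  Insertion sort shows that ⟨T⟩ consists
-- exactly of the subchains of E, so TTL gives a subchain α that cannot be
-- extended by one element.  Any upper bound a ∈ E of α is then maximal: if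
-- a < c ∈ E, then c lies strictly above α, and α ∪ {c} is a subchain.
-- Intuitionistically, Refl _<_ b a and a < c only give ¬ ¬ (b < c).  But the
-- goal is an absurdity, so it suffices to treat the case a ∈ α (were a ∉ α,
-- then α ∪ {a} would be a subchain), in which b and a are comparable.
--
-- Zorn-𝒫 → TTL.  The union of a chain F in ⟨T⟩ is again in ⟨T⟩, since a
-- nonempty list included in the union is included in some member of F.
module Submission where

open import Data.List.Base using (List; []; _∷_; [_]; _++_; _∷ʳ_)
open import Data.List.Membership.Propositional using () renaming (_∈_ to _∈ᴸ_)
open import Data.List.Relation.Binary.Subset.Propositional using () renaming (_⊆_ to _⊆ᴸ_)
open import Data.List.Relation.Binary.Subset.Propositional.Properties
  using (∷⁺ʳ; ∈-∷⁺ʳ)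
open import Data.List.Relation.Unary.All as All using (All; []; _∷_)
open import Data.List.Relation.Unary.All.Properties as All using (anti-mono; ++⁻ˡ; ++⁻ʳ)
open import Data.List.Relation.Unary.AllPairs using (AllPairs; []; _∷_)
open import Data.List.Relation.Unary.AllPairs.Properties using (++⁺)
open import Data.List.Relation.Unary.Any using (here; there)
open import Data.Product.Base using (Σ; _×_; _,_)
open import Data.Sum.Base using (_⊎_; inj₁; inj₂)
open import Function.Base using (_∘_; id)
open import Function.Bundles using (_⇔_; mk⇔)
open import Level using (Level)
open import Relation.Binary.Core using (Rel)
open import Relation.Binary.Definitions using (Transitive)
open import Relation.Binary.PropositionalEquality.Core using (_≡_; refl; sym; subst)
open import Defs using (HigherOrderLogic; module Principles)

private
  variable
    a ℓ : Level

module _ {A : Set a} {R : Rel A ℓ} where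

  AllPairs-++⁻ : ∀ u {v} → AllPairs R (u ++ v) →
                 AllPairs R u × AllPairs R v × All (λ x → All (R x) v) u
  AllPairs-++⁻ []      Rv        = [] , Rv , []
  AllPairs-++⁻ (x ∷ u) (Rx ∷ Ruv) =
    let Ru , Rv , Ruv′ = AllPairs-++⁻ u Ruv in
    ++⁻ˡ u Rx ∷ Ru , Rv , ++⁻ʳ u Rx ∷ Ruv′

  AllPairs-remove : ∀ u {v x} → AllPairs R (u ++ x ∷ v) → AllPairs R (u ++ v)
  AllPairs-remove u Ruxv with AllPairs-++⁻ u Ruxv
  ... | Ru , _ ∷ Rv , Ru,xv = ++⁺ Ru Rv (All.map All.tail Ru,xv)

  AllPairs-glue : Transitive R → ∀ u {v x} →
                  AllPairs R (u ∷ʳ x) → AllPairs R (x ∷ v) → AllPairs R (u ++ x ∷ v)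
  AllPairs-glue tr u Rux (Rxv ∷ Rv) with AllPairs-++⁻ u Rux
  ... | Ru , _ , Ru,x =
    ++⁺ Ru (Rxv ∷ Rv) (All.map (λ { (Ryx ∷ []) → Ryx ∷ All.map (tr Ryx) Rxv }) Ru,x)

  AllPairs-unglue : ∀ u {v x} → AllPairs R (u ++ x ∷ v) →
                    AllPairs R (u ∷ʳ x) × AllPairs R (x ∷ v)
  AllPairs-unglue u Ruxv =
    let Ru , Rxv , Ru,xv = AllPairs-++⁻ u Ruxv in
    ++⁺ Ru ([] ∷ []) (All.map (λ { (Ryx ∷ _) → Ryx ∷ [] }) Ru,xv) , Rxv

  AllPairs-between : ∀ u v {w x y} → AllPairs R (u ++ x ∷ v ++ y ∷ w) → R x y
  AllPairs-between u v Ruxvyw with AllPairs-++⁻ u Ruxvyw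
  ... | _ , Rx ∷ _ , _ = All.head (++⁻ʳ v Rx)

  AllPairs-comparable : ∀ {u x y} → AllPairs R u → x ∈ᴸ u → y ∈ᴸ u →
                        R x y ⊎ R y x ⊎ x ≡ y
  AllPairs-comparable _        (here refl) (here refl) = inj₂ (inj₂ refl)
  AllPairs-comparable (Rx ∷ _) (here refl) (there y∈u) = inj₁ (All.lookup Rx y∈u)
  AllPairs-comparable (Ry ∷ _) (there x∈u) (here refl) = inj₂ (inj₁ (All.lookup Ry x∈u))
  AllPairs-comparable (_ ∷ Ru) (there x∈u) (there y∈u) = AllPairs-comparable Ru x∈u y∈u

module _ (L : HigherOrderLogic) where
  open Principles L hiding (_⇔_)

  infixl 1 _>>=_
  infixl 9 _·_

  _>>=_ : {X : Set} {p : Ω} → ⊢ ∥ X ∥ → (X → ⊢ p) → ⊢ p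
  x >>= f = ∥∥-elim f x

  _·_ : {X : Set} {P : X → Ω} → ⊢ ∥ (∀ x → ⊢ P x) ∥ → ∀ x → ⊢ P x
  f · x = f >>= λ g → g x

  absurd : {p : Ω} → ⊢ ⊥′ → ⊢ p
  absurd = ∥∥-elim λ ()

  curry : {X Y : Set} {p : Ω} → (X → Y → ⊢ p) → ⊢ ∥ X × Y ∥ → ⊢ p
  curry f = ∥∥-elim λ (x , y) → f x y

  module _ {A : Set} where

    ⊂ˡ⇒All : {u : List A} {α : 𝒫 A} → ⊢ u ⊂ˡ α → All (λ x → ⊢ α x) u
    ⊂ˡ⇒All u⊂α = All.tabulate λ {x} x∈u → u⊂α · x · ∥∥-intro x∈u

    All⇒⊂ˡ : {u : List A} {α : 𝒫 A} → All (λ x → ⊢ α x) u → ⊢ u ⊂ˡ α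
    All⇒⊂ˡ αu = ∥∥-intro λ x → ∥∥-intro (∥∥-elim (All.lookup αu))

    ⊆ᴸ⇒⊆ˡ : {u v : List A} → u ⊆ᴸ v → ⊢ u ⊆ˡ v
    ⊆ᴸ⇒⊆ˡ u⊆v = ∥∥-intro λ x → ∥∥-intro (∥∥-elim (∥∥-intro ∘ u⊆v))

    _∪｛_｝ : 𝒫 A → A → 𝒫 A
    (α ∪｛ a ｝) x = x ∈ α ∨ x ≐ a

    Max≺⇒∉ : {P : 𝒫 (𝒫 A)} {α : 𝒫 A} {a : A} → ⊢ α ∈ Max≺ P → ⊢ a ∉ α →
             ⊢ (α ∪｛ a ｝) ∈ P → ⊢ ⊥′
    Max≺⇒∉ {α = α} {a} max a∉α ∈P = do
      _ , no-extension ← max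
      no-extension · (α ∪｛ a ｝)
        · ∥∥-intro (a , ∥∥-intro (a∉α , ∥∥-intro refl)) · ∈P

    ⊂-strictOrder : ⊢ StrictOrder (_⊂_ {A})
    ⊂-strictOrder = ∥∥-intro
      ( (∥∥-intro λ α → ∥∥-intro (curry λ _ α≠α → α≠α · ∥∥-intro refl))
      , (∥∥-intro λ α → ∥∥-intro λ β → ∥∥-intro λ γ →
         ∥∥-intro λ α⊂β → ∥∥-intro λ β⊂γ → ⊂-trans α β γ α⊂β β⊂γ))
      where
      ⊂-trans : (α β γ : 𝒫 A) → ⊢ α ⊂ β → ⊢ β ⊂ γ → ⊢ α ⊂ γ
      ⊂-trans α β γ α⊂β β⊂γ = do
        α⊆β , α≠β ← α⊂β
        β⊆γ , _   ← β⊂γ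
        ∥∥-intro
          ( (∥∥-intro λ x → ∥∥-intro λ x∈α → β⊆γ · x · (α⊆β · x · x∈α))
          , ∥∥-intro λ α≐γ → do
              refl ← α≐γ
              α≠β · predicate-ext α β (λ x x∈α → α⊆β · x · x∈α) (λ x x∈β → β⊆γ · x · x∈β))

  module _ {A : Set} (_<_ : A → A → Ω) (E : 𝒫 A)
           (irreflexive : ∀ x → ⊢ x < x → ⊢ ⊥′)
           (transitive : Transitive (λ x y → ⊢ x < y)) where

    Increasing : List A → Set
    Increasing = AllPairs (λ x y → ⊢ x < y)

    record SortedVersion (u : List A) : Set where
      constructor sorted
      field
        list       : List A
        increasing : Increasing list
        ⊆list      : u ⊆ᴸ list
        list⊆      : list ⊆ᴸ u

    IncreasingIn : 𝒫 (List A)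
    IncreasingIn w = ∥ All (λ x → ⊢ E x) w × Increasing w ∥

    Chains : 𝒫 (List A)
    Chains u = ∃[ w ∶ List A ] (w ∈ IncreasingIn ∧ u ⊆ˡ w)

    IncreasingIn-isChainBasis : ⊢ IsChainBasis IncreasingIn
    IncreasingIn-isChainBasis = ∥∥-intro (∥∥-intro ([] , []) , ∥∥-intro
      ( (∥∥-intro λ u → ∥∥-intro λ v → ∥∥-intro λ a → ∥∥-intro
          ( ∥∥-intro (curry λ ua∈ av∈ → do
              Eua , <ua ← ua∈
              Eav , <av ← av∈
              ∥∥-intro (All.++⁺ (++⁻ˡ u Eua) Eav , AllPairs-glue transitive u <ua <av))
          , ∥∥-intro (curry λ Euav <uav →
              let Eu , Eav = All.++⁻ u Euav
                  <ua , <av = AllPairs-unglue u <uav in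
              ∥∥-intro ( ∥∥-intro (All.++⁺ Eu (All.head Eav ∷ []) , <ua)
                       , ∥∥-intro (Eav , <av)))))
      , ∥∥-intro
      ( (∥∥-intro λ u → ∥∥-intro λ v → ∥∥-intro λ a → ∥∥-intro
          (curry λ Euav <uav →
            let Eu , Eav = All.++⁻ u Euav in
            ∥∥-intro (All.++⁺ Eu (All.tail Eav) , AllPairs-remove u <uav)))
      , (∥∥-intro λ a → ∥∥-intro λ b → ∥∥-intro λ u → ∥∥-intro λ v → ∥∥-intro λ w →
          ∥∥-intro (curry λ _ uavbw∈ →
            ∥∥-intro λ u′ → ∥∥-intro λ v′ → ∥∥-intro λ w′ →
            ∥∥-intro λ u′bv′aw′∈ → do
              _ , <uavbw ← uavbw∈
              _ , <u′bv′aw′ ← u′bv′aw′∈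
              irreflexive a (transitive (AllPairs-between u v <uavbw)
                                        (AllPairs-between u′ v′ <u′bv′aw′)))))))

    Chains∈𝐂 : ⊢ Chains ∈ 𝐂 A
    Chains∈𝐂 = ∥∥-intro (IncreasingIn , ∥∥-intro
      (IncreasingIn-isChainBasis , ∥∥-intro λ u → ∥∥-intro (∥∥-intro id , ∥∥-intro id)))

    module _ (F : 𝒫 A) (chain : ⊢ IsChain _<_ F) where

      insert : ∀ {w a} → All (λ x → ⊢ F x) w → Increasing w → ⊢ F a →
               ⊢ ∥ SortedVersion (a ∷ w) ∥
      insert {a = a} [] [] Fa = ∥∥-intro (sorted [ a ] ([] ∷ []) id id)
      insert {h ∷ w} {a} (Fh ∷ Fw) (h<w ∷ <w) Fa =
        chain · a · h · ∥∥-intro (Fa , Fh) >>= λ where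
          (inj₁ a<h) → ∥∥-intro
            (sorted (a ∷ h ∷ w) ((a<h ∷ All.map (transitive a<h) h<w) ∷ h<w ∷ <w) id id)
          (inj₂ h<a∨a≐h) → h<a∨a≐h >>= λ where
            (inj₁ h<a) → do
              sorted w′ <w′ aw⊆w′ w′⊆aw ← insert Fw <w Fa
              ∥∥-intro (sorted (h ∷ w′)
                (anti-mono w′⊆aw (h<a ∷ h<w) ∷ <w′)
                (∈-∷⁺ʳ (there (aw⊆w′ (here refl))) (∷⁺ʳ h (aw⊆w′ ∘ there)))
                (∈-∷⁺ʳ (there (here refl)) (∷⁺ʳ a there ∘ w′⊆aw)))
            (inj₂ a≐h) → do
              refl ← a≐h
              ∥∥-intro (sorted (h ∷ w) (h<w ∷ <w) (∈-∷⁺ʳ (here refl) id) there)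

      sort : ∀ {u} → All (λ x → ⊢ F x) u → ⊢ ∥ SortedVersion u ∥
      sort [] = ∥∥-intro (sorted [] [] id id)
      sort {a ∷ u} (Fa ∷ Fu) = do
        sorted w <w u⊆w w⊆u ← sort Fu
        sorted w′ <w′ aw⊆w′ w′⊆aw ← insert (anti-mono w⊆u Fu) <w Fa
        ∥∥-intro (sorted w′ <w′ (aw⊆w′ ∘ ∷⁺ʳ a u⊆w) (∷⁺ʳ a w⊆u ∘ w′⊆aw))

    subchain⇒∈⟨Chains⟩ : ∀ {F} → ⊢ IsSubchain _<_ E F → ⊢ F ∈ ⟨ Chains ⟩
    subchain⇒∈⟨Chains⟩ {F} = curry λ F⊆E chain →
      ∥∥-intro λ u → ∥∥-intro λ u⊂F → do
        let Fu = ⊂ˡ⇒All u⊂F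
        sorted w <w u⊆w w⊆u ← sort F chain Fu
        let Ew = All.map (λ {x} Fx → F⊆E · x · Fx) (anti-mono w⊆u Fu)
        ∥∥-intro (w , ∥∥-intro (∥∥-intro (Ew , <w) , ⊆ᴸ⇒⊆ˡ u⊆w))

    ∈⟨Chains⟩⇒subchain : ∀ {F} → ⊢ F ∈ ⟨ Chains ⟩ → ⊢ IsSubchain _<_ E F
    ∈⟨Chains⟩⇒subchain {F} F∈ = ∥∥-intro
      ( (∥∥-intro λ x → ∥∥-intro λ Fx →
          increasing-superlist (Fx ∷ []) >>= λ (w , Ew , <w , u⊆w) →
          u⊆w · x · ∥∥-intro (here refl) >>= All.lookup Ew)
      , (∥∥-intro λ x → ∥∥-intro λ y → ∥∥-intro (curry λ Fx Fy → do
          w , _ , <w , u⊆w ← increasing-superlist (Fx ∷ Fy ∷ [])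
          x∈w ← u⊆w · x · ∥∥-intro (here refl)
          y∈w ← u⊆w · y · ∥∥-intro (there (here refl))
          comparable (AllPairs-comparable <w x∈w y∈w))))
      where
      increasing-superlist : ∀ {u} → All (λ x → ⊢ F x) u →
        ⊢ ∥ Σ (List A) (λ w → All (λ x → ⊢ E x) w × Increasing w × (⊢ u ⊆ˡ w)) ∥
      increasing-superlist {u} Fu = do
        w , w∈∧u⊆w ← F∈ · u · All⇒⊂ˡ Fu
        w∈ , u⊆w ← w∈∧u⊆w
        Ew , <w ← w∈
        ∥∥-intro (w , Ew , <w , u⊆w)

      comparable : ∀ {x y} → (⊢ x < y) ⊎ (⊢ y < x) ⊎ x ≡ y → ⊢ (x < y ∨ y < x ∨ x ≐ y)
      comparable (inj₁ x<y)        = ∥∥-intro (inj₁ x<y)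
      comparable (inj₂ (inj₁ y<x)) = ∥∥-intro (inj₂ (∥∥-intro (inj₁ y<x)))
      comparable (inj₂ (inj₂ x≡y)) = ∥∥-intro (inj₂ (∥∥-intro (inj₂ (∥∥-intro x≡y))))

    ∪-subchain : ∀ {F c} → ⊢ IsSubchain _<_ E F → ⊢ c ∈ E → (∀ b → ⊢ b ∈ F → ⊢ b < c) →
                 ⊢ IsSubchain _<_ E (F ∪｛ c ｝)
    ∪-subchain {F} {c} subchain c∈E F<c = do
      F⊆E , chain ← subchain
      ∥∥-intro
        ( (∥∥-intro λ x → ∥∥-intro (∥∥-elim λ where
            (inj₁ x∈F) → F⊆E · x · x∈F
            (inj₂ x≐c) → x≐c >>= λ where refl → c∈E))
        , (∥∥-intro λ x → ∥∥-intro λ y → ∥∥-intro (curry λ x∈ y∈ →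
            x∈ >>= λ where
              (inj₁ x∈F) → y∈ >>= λ where
                (inj₁ y∈F) → chain · x · y · ∥∥-intro (x∈F , y∈F)
                (inj₂ y≐c) → y≐c >>= λ where refl → ∥∥-intro (inj₁ (F<c x x∈F))
              (inj₂ x≐c) → x≐c >>= λ where
                refl → y∈ >>= λ where
                  (inj₁ y∈F) → ∥∥-intro (inj₂ (∥∥-intro (inj₁ (F<c y y∈F))))
                  (inj₂ y≐c) → y≐c >>= λ where
                    refl → ∥∥-intro (inj₂ (∥∥-intro (inj₂ (∥∥-intro refl)))))))

    max-chain-bound : ∀ {α a} → ⊢ α ∈ Max≺ ⟨ Chains ⟩ → ⊢ a ∈ E →
                      (∀ b → ⊢ b ∈ α → ⊢ Refl _<_ b a) → ⊢ a ∈ Max _<_ E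
    max-chain-bound {α} {a} max a∈E bound = ∥∥-intro (a∈E , ∥∥-intro λ c →
      ∥∥-intro λ a<c → ∥∥-intro λ c∈E → do
        α∈ , _ ← max
        let subchain = ∈⟨Chains⟩⇒subchain α∈
        _ , chain ← subchain

        let no-strict-bound : ∀ {d} → ⊢ d ∈ E → (∀ b → ⊢ b ∈ α → ⊢ b < d) → ⊢ ⊥′
            no-strict-bound {d} d∈E α<d = Max≺⇒∉ max
              (∥∥-intro λ d∈α → irreflexive d (α<d d d∈α))
              (subchain⇒∈⟨Chains⟩ (∪-subchain subchain d∈E α<d))

            b<c : ⊢ a ∈ α → ∀ b → ⊢ b ∈ α → ⊢ b < c
            b<c a∈α b b∈α = chain · b · a · ∥∥-intro (b∈α , a∈α) >>= λ where
              (inj₁ b<a) → transitive b<a a<c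
              (inj₂ a<b∨b≐a) → a<b∨b≐a >>= λ where
                (inj₁ a<b) →
                  let b≠a = ∥∥-intro (∥∥-elim λ { refl → irreflexive a a<b }) in
                  absurd (irreflexive a (transitive a<b (bound b b∈α · b≠a)))
                (inj₂ b≐a) → b≐a >>= λ where refl → a<c

            a∉α : ⊢ a ∉ α
            a∉α = ∥∥-intro λ a∈α → no-strict-bound c∈E (b<c a∈α)

        no-strict-bound a∈E λ b b∈α →
          bound b b∈α · ∥∥-intro (∥∥-elim λ { refl → a∉α · b∈α }))

  TTL-𝐂⇒Zorn : TTL-𝐂 → Zorn
  TTL-𝐂⇒Zorn ttl A _<_ E strictOrder = ∥∥-intro λ E-inductive → do
    irreflexive , transitive ← strictOrder
    let irr = λ x x<x → irreflexive · x · x<x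
        tr = λ {x} {y} {z} x<y y<z → transitive · x · y · z · x<y · y<z
        T = Chains _<_ E irr tr
        ∅∈⟨T⟩ = ∥∥-intro ((λ _ → ⊥′) , subchain⇒∈⟨Chains⟩ _<_ E irr tr (∥∥-intro
          ( (∥∥-intro λ _ → ∥∥-intro absurd)
          , (∥∥-intro λ _ → ∥∥-intro λ _ → ∥∥-intro (curry λ x∈∅ _ → absurd x∈∅)))))
    α , max ← ttl A T (Chains∈𝐂 _<_ E irr tr) · ∅∈⟨T⟩
    α∈ , _ ← max
    a , bound ← E-inductive · α · ∈⟨Chains⟩⇒subchain _<_ E irr tr α∈
    a∈E , α≤a ← bound
    ∥∥-intro (a , max-chain-bound _<_ E irr tr max a∈E (λ b b∈α → α≤a · b · b∈α))

  ⋃ : {A : Set} → 𝒫 (𝒫 A) → 𝒫 A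
  ⋃ {A} F x = ∃[ α ∶ 𝒫 A ] (α ∈ F ∧ x ∈ α)

  module _ {A : Set} {T : 𝒫 (List A)} where

    member-⊇ : {F : 𝒫 (𝒫 A)} → ⊢ IsChain _⊂_ F → ∀ {x u} → All (λ y → ⊢ ⋃ F y) (x ∷ u) →
               ⊢ ∥ Σ (𝒫 A) (λ α → (⊢ α ∈ F) × All (λ y → ⊢ α y) (x ∷ u)) ∥
    member-⊇ chain (x∈⋃F ∷ []) = do
      α , α∈F∧x∈α ← x∈⋃F
      α∈F , x∈α ← α∈F∧x∈α
      ∥∥-intro (α , α∈F , x∈α ∷ [])
    member-⊇ chain (x∈⋃F ∷ u⊂⋃F@(_ ∷ _)) = do
      α , α∈F∧x∈α ← x∈⋃F
      α∈F , x∈α ← α∈F∧x∈α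
      β , β∈F , u⊂β ← member-⊇ chain u⊂⋃F
      chain · α · β · ∥∥-intro (α∈F , β∈F) >>= λ where
        (inj₁ α⊂β) → do
          α⊆β , _ ← α⊂β
          ∥∥-intro (β , β∈F , (α⊆β · _ · x∈α) ∷ u⊂β)
        (inj₂ β⊂α∨α≐β) → β⊂α∨α≐β >>= λ where
          (inj₁ β⊂α) → do
            β⊆α , _ ← β⊂α
            ∥∥-intro (α , α∈F , x∈α ∷ All.map (λ y∈β → β⊆α · _ · y∈β) u⊂β)
          (inj₂ α≐β) → do
            refl ← α≐β
            ∥∥-intro (α , α∈F , x∈α ∷ u⊂β)

    ⋃∈⟨⟩ : {F : 𝒫 (𝒫 A)} → ⊢ [] ∈ T → ⊢ IsSubchain _⊂_ ⟨ T ⟩ F → ⊢ ⋃ F ∈ ⟨ T ⟩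
    ⋃∈⟨⟩ {F} []∈T = curry λ F⊆⟨T⟩ chain → ∥∥-intro λ where
      []      → ∥∥-intro λ _ → []∈T
      (x ∷ u) → ∥∥-intro λ xu⊂⋃F → do
        α , α∈F , xu⊂α ← member-⊇ chain (⊂ˡ⇒All xu⊂⋃F)
        F⊆⟨T⟩ · α · α∈F · (x ∷ u) · All⇒⊂ˡ xu⊂α

    ⟨⟩-inductive : ⊢ [] ∈ T → ⊢ Inductive _⊂_ ⟨ T ⟩
    ⟨⟩-inductive []∈T = ∥∥-intro λ F → ∥∥-intro λ subchain →
      ∥∥-intro (⋃ F , ∥∥-intro
        ( ⋃∈⟨⟩ []∈T subchain
        , (∥∥-intro λ β → ∥∥-intro λ β∈F → ⊆⇒Refl-⊂ β (⋃ F)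
            (∥∥-intro λ x → ∥∥-intro λ x∈β → ∥∥-intro (β , ∥∥-intro (β∈F , x∈β))))))

  ≺⇒⊂ : {A : Set} {α β : 𝒫 A} → ⊢ β ≺ α → ⊢ α ⊂ β
  ≺⇒⊂ β≺α = do
    a , a∉α∧β≐ ← β≺α
    a∉α , β≐ ← a∉α∧β≐
    refl ← β≐
    ∥∥-intro
      ( (∥∥-intro λ x → ∥∥-intro λ x∈α → ∥∥-intro (inj₁ x∈α))
      , ∥∥-intro λ α≐β → a∉α · (α≐β >>= λ α≡β →
          subst (λ γ → ⊢ a ∈ γ) (sym α≡β) (∥∥-intro (inj₂ (∥∥-intro refl)))))

  Zorn-𝒫⇒TTL : Zorn-𝒫 → TTL
  Zorn-𝒫⇒TTL zorn A T = ∥∥-intro λ nonempty → do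
    α₀ , α₀∈ ← nonempty
    α , max ← zorn A T · ⟨⟩-inductive (α₀∈ · [] · All⇒⊂ˡ [])
    α∈ , maximal ← max
    ∥∥-intro (α , ∥∥-intro (α∈ , ∥∥-intro λ β → ∥∥-intro λ β≺α → maximal · β · ≺⇒⊂ β≺α))

corollary22 : (L : HigherOrderLogic) →
    let open Principles L hiding (_⇔_) in
    (TTL-𝐂 → Zorn) × (Zorn-𝒫 → TTL) × (TTL ⇔ TTL-𝐂) × (Zorn ⇔ Zorn-𝒫)
corollary22 L =
    TTL-𝐂⇒Zorn L
  , Zorn-𝒫⇒TTL L
  , mk⇔ (λ ttl A T _ → ttl A T) (Zorn-𝒫⇒TTL L ∘ Zorn⇒Zorn-𝒫 ∘ TTL-𝐂⇒Zorn L)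
  , mk⇔ Zorn⇒Zorn-𝒫 (λ zorn → TTL-𝐂⇒Zorn L (λ A T _ → Zorn-𝒫⇒TTL L zorn A T))
  where
  open Principles L using (Zorn; Zorn-𝒫; ⟨_⟩; _⊂_)

  Zorn⇒Zorn-𝒫 : Zorn → Zorn-𝒫
  Zorn⇒Zorn-𝒫 zorn A T = zorn _ _⊂_ ⟨ T ⟩ (⊂-strictOrder L)
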